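{- Let $G$ be a chordless graph. Then either $G$ is sparse or $G$ admits a $1$-cutset or a proper $2$-cutset.
   Context: Graphs are finite and simple. A graph is chordless if all its cycles are chordless, i.e. every cycle of it is an induced subgraph. A graph $G$ is sparse if for every edge $uv$ of $G$ we have $\deg(u)\le 2$ or $\deg(v)\le 2$. A $k$-cutset of $G$ is a set $S\subset V(G)$ of size $k$ such that $G\setminus S$ is disconnected. A proper $2$-cutset of $G$ is a $2$-cutset $\{a,b\}$ such that $ab\notin E(G)$ and $V(G)\setminus\{a,b\}$ can be partitioned into two non-empty sets $X,Y$ with no edge between $X$ and $Y$ and such that neither $G[X\cup\{a,b\}]$ nor $G[Y\cup\{a,b\}]$ is a path with ends $a,b$. -}

module Defs where

open import Data.Fin.Base using (Fin)
open import Data.Fin.Subset using (Subset; _∈_; _∪_; _∩_; ∁; ⁅_⁆; ∣_∣; Nonempty; Empty)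
open import Data.List.Base using (List; []; _∷_; length)
open import Data.List.Membership.Propositional using () renaming (_∈_ to _∈ˡ_)
open import Data.List.Relation.Unary.All using (All)
open import Data.List.Relation.Unary.Unique.Propositional using (Unique)
open import Data.Nat.Base using (ℕ; _≤_)
open import Data.Product.Base using (∃-syntax; _×_)
open import Data.Sum.Base using (_⊎_)
open import Data.Vec.Base using (tabulate)
open import Function.Bundles using (_⇔_)
open import Level using (0ℓ)
open import Relation.Binary.Core using (Rel)
open import Relation.Binary.Construct.Closure.Symmetric using (SymClosure)
open import Relation.Binary.Definitions using (Decidable; Irreflexive; Symmetric)
open import Relation.Binary.PropositionalEquality.Core using (_≡_)
open import Relation.Nullary using (¬_; does)

record Graph (n : ℕ) : Set₁ where
  infix 4 _~_ _~?_
  field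
    _~_    : Rel (Fin n) 0ℓ
    _~?_   : Decidable _~_
    sym    : Symmetric _~_
    irrefl : Irreflexive _≡_ _~_

data Consecutive {A : Set} : List A → A → A → Set where
  here  : ∀ {x y zs} → Consecutive (x ∷ y ∷ zs) x y
  there : ∀ {x y z zs} → Consecutive zs x y → Consecutive (z ∷ zs) x y

module _ {n : ℕ} (G : Graph n) where
  open Graph G

  neighbours : Fin n → Subset n
  neighbours u = tabulate (λ v → does (u ~? v))

  deg : Fin n → ℕ
  deg u = ∣ neighbours u ∣

  Sparse : Set
  Sparse = ∀ u v → u ~ v → deg u ≤ 2 ⊎ deg v ≤ 2

  -- Walk u v vs: vs lists, in order and with both ends included, the vertices
  -- of a walk from u to v.
  data Walk : Fin n → Fin n → List (Fin n) → Set where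
    stop : ∀ {u} → Walk u u (u ∷ [])
    step : ∀ {u v w vs} → u ~ v → Walk v w vs → Walk u w (u ∷ vs)

  Path : Fin n → Fin n → List (Fin n) → Set
  Path u v vs = Walk u v vs × Unique vs

  -- A cycle is a path on at least three vertices whose ends u, v are joined
  -- by the closing edge.
  Cycle : Fin n → Fin n → List (Fin n) → Set
  Cycle u v vs = Path u v vs × 3 ≤ length vs × v ~ u

  PathEdge : List (Fin n) → Rel (Fin n) 0ℓ
  PathEdge vs = SymClosure (Consecutive vs)

  -- Here v is the last vertex of vs, so putting it in front of vs as well
  -- adds the closing edge.
  CycleEdge : Fin n → List (Fin n) → Rel (Fin n) 0ℓ
  CycleEdge v vs = SymClosure (Consecutive (v ∷ vs))

  -- The subgraph of G with vertices vs and edge relation E is induced.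
  Induced : List (Fin n) → Rel (Fin n) 0ℓ → Set
  Induced vs E = ∀ x y → x ∈ˡ vs → y ∈ˡ vs → x ~ y → E x y

  Chordless : Set
  Chordless = ∀ u v vs → Cycle u v vs → Induced vs (CycleEdge v vs)

  -- G[S] is connected.  The empty graph counts as connected.
  ConnectedOn : Subset n → Set
  ConnectedOn S = ∀ u v → u ∈ S → v ∈ S → ∃[ vs ] Path u v vs × All (_∈ S) vs

  IsCutset : ℕ → Subset n → Set
  IsCutset k S = ∣ S ∣ ≡ k × ¬ ConnectedOn (∁ S)

  HasCutset : ℕ → Set
  HasCutset k = ∃[ S ] IsCutset k S

  -- G[S] is a path with ends a, b.
  IsPathOn : Subset n → Fin n → Fin n → Set
  IsPathOn S a b =
    ∃[ vs ] Path a b vs × (∀ x → x ∈ˡ vs ⇔ x ∈ S) × Induced vs (PathEdge vs)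

  -- (X , Y) witnesses that the 2-cutset {a , b} is proper.
  ProperSplit : Fin n → Fin n → Subset n → Subset n → Set
  ProperSplit a b X Y =
    Nonempty X × Nonempty Y ×
    Empty (X ∩ Y) × X ∪ Y ≡ ∁ (⁅ a ⁆ ∪ ⁅ b ⁆) ×
    (∀ x y → x ∈ X → y ∈ Y → ¬ x ~ y) ×
    ¬ IsPathOn (X ∪ (⁅ a ⁆ ∪ ⁅ b ⁆)) a b ×
    ¬ IsPathOn (Y ∪ (⁅ a ⁆ ∪ ⁅ b ⁆)) a b

  IsProper2Cutset : Fin n → Fin n → Set
  IsProper2Cutset a b =
    IsCutset 2 (⁅ a ⁆ ∪ ⁅ b ⁆) × ¬ a ~ b × ∃[ X ] ∃[ Y ] ProperSplit a b X Y

  HasProper2Cutset : Set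
  HasProper2Cutset = ∃[ a ] ∃[ b ] IsProper2Cutset a b

{-# OPTIONS --safe #-}
module Submission where

-- Let uv be an edge with deg u, deg v ≥ 3 in a chordless graph G without a
-- 1-cutset, and put H = G − uv.  A cycle of H through u and v would have the
-- chord uv, so by the two-path case of Menger's theorem some x separates u from
-- v in H; that is, uv is a bridge of G − x, with sides U ∋ u and V ∋ v.  If x is
-- not adjacent to u then {u , x} is a proper 2-cutset: u has two neighbours in
-- U, and all three or more neighbours of v lie in V ∪ {u , x}.  Likewise for v.
-- If x is adjacent to both, a path from U to x avoiding u closes up with x v u
-- to a cycle with chord ux.
--
-- For Menger, a pair of internally disjoint paths from w to u is moved along an
-- edge zw: follow a path from z to u that avoids w until it hits one of the two
-- paths and continue along that one; the other path is extended by zw.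

open import Defs
open import Data.Empty using (⊥; ⊥-elim)
open import Data.Fin.Base using (Fin; zero; suc)
open import Data.Fin.Properties using (_≟_; any?; all?; ¬∀⟶∃¬; injective⇒≤)
open import Data.Fin.Subset using (Subset; ⁅_⁆; ∁; _∪_; ∣_∣; inside; outside)
  renaming (_∈_ to _∈ˢ_; ⊥ to ∅)
import Data.Fin.Subset.Properties as Subset
open import Data.List.Base using (List; []; _∷_; length; lookup)
import Data.List.Membership.DecPropositional as DecMembership
open import Data.List.Membership.Propositional using (_∈_; _∉_)
open import Data.List.Membership.Propositional.Properties using (∈-lookup)
open import Data.List.Relation.Binary.Disjoint.Propositional using (Disjoint)
open import Data.List.Relation.Binary.Subset.Propositional using (_⊆_)
open import Data.List.Relation.Unary.All as All using (All; []; _∷_)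
open import Data.List.Relation.Unary.All.Properties using (¬Any⇒All¬; All¬⇒¬Any; anti-mono)
open import Data.List.Relation.Unary.Any using (here; there)
open import Data.List.Relation.Unary.Unique.Propositional using (Unique; []; _∷_)
open import Data.Nat.Base using (ℕ; zero; suc; _≤_; _<_; z≤n; s≤s)
import Data.Nat.Properties as ℕ
open import Data.Product.Base using (∃-syntax; _×_; _,_; proj₁; proj₂; swap; uncurry)
open import Data.Sum.Base using (_⊎_; inj₁; inj₂; [_,_]′)
import Data.Sum.Base as Sum
open import Data.Unit.Base using (⊤; tt)
open import Data.Vec.Base using (tabulate; _∷_)
open import Data.Vec.Properties using ([]=⇒lookup; lookup⇒[]=; lookup∘tabulate)
open import Function.Base using (_∘_; id)
open import Function.Bundles using (Equivalence)
open import Level using (0ℓ)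
open import Relation.Binary.Construct.Closure.ReflexiveTransitive
  using (Star; ε; _◅_; _◅◅_; reverse; kleisliStar)
import Relation.Binary.Construct.Closure.ReflexiveTransitive as Star
open import Relation.Binary.Construct.Closure.Symmetric using (fwd; bwd)
import Relation.Binary.Construct.Closure.Symmetric as SymClosure
open import Relation.Binary.Core using (Rel)
open import Relation.Binary.Definitions using (Decidable; Symmetric)
open import Relation.Binary.PropositionalEquality
  using (_≡_; _≢_; refl; sym; trans; cong; subst; ≢-sym)
open import Relation.Nullary
  using (¬_; Dec; yes; no; does; contradiction; ¬?; _×-dec_; _→-dec_)
open import Relation.Nullary.Decidable using (map′; dec-true; decidable-stable)
open import Relation.Unary using (Pred)
import Relation.Unary as Unary
open import Relation.Unary.Properties using (∁?; _∩?_)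

private variable
  n : ℕ
  A : Set
  x y z : A
  xs : List A

-- Lists without repetition

Unique-head : Unique (x ∷ xs) → x ∉ xs
Unique-head (x∉ ∷ _) = All¬⇒¬Any x∉

Unique-tail : Unique (x ∷ xs) → Unique xs
Unique-tail (_ ∷ uniq) = uniq

Unique-∷ : x ∉ xs → Unique xs → Unique (x ∷ xs)
Unique-∷ x∉ uniq = ¬Any⇒All¬ _ x∉ ∷ uniq

lookup-injective : Unique xs → ∀ {i j} → lookup xs i ≡ lookup xs j → i ≡ j
lookup-injective {xs = _ ∷ _} u {zero}  {zero}  eq = refl
lookup-injective {xs = _ ∷ _} u {zero}  {suc j} eq =
  contradiction (subst (_∈ _) (sym eq) (∈-lookup j)) (Unique-head u)
lookup-injective {xs = _ ∷ _} u {suc i} {zero}  eq =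
  contradiction (subst (_∈ _) eq (∈-lookup i)) (Unique-head u)
lookup-injective {xs = _ ∷ _} (_ ∷ u) {suc i} {suc j} eq = cong suc (lookup-injective u eq)

Unique⇒length≤n : {vs : List (Fin n)} → Unique vs → length vs ≤ n
Unique⇒length≤n uniq = injective⇒≤ (lookup-injective uniq)

Consecutive⇒∈ˡ : Consecutive xs x y → x ∈ xs
Consecutive⇒∈ˡ here      = here refl
Consecutive⇒∈ˡ (there c) = there (Consecutive⇒∈ˡ c)

Consecutive⇒∈ʳ : Consecutive (z ∷ xs) x y → y ∈ xs
Consecutive⇒∈ʳ here = here refl
Consecutive⇒∈ʳ {xs = _ ∷ _} (there c) = there (Consecutive⇒∈ʳ c)

successor-unique : Unique xs → Consecutive xs x y → Consecutive xs x z → y ≡ z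
successor-unique u here here = refl
successor-unique u here (there c) = contradiction (Consecutive⇒∈ˡ c) (Unique-head u)
successor-unique u (there c) here = contradiction (Consecutive⇒∈ˡ c) (Unique-head u)
successor-unique (_ ∷ u) (there c) (there d) = successor-unique u c d

predecessor-unique : Unique xs → Consecutive xs y x → Consecutive xs z x → y ≡ z
predecessor-unique u here here = refl
predecessor-unique (_ ∷ u) here (there c) = contradiction (Consecutive⇒∈ʳ c) (Unique-head u)
predecessor-unique (_ ∷ u) (there c) here = contradiction (Consecutive⇒∈ʳ c) (Unique-head u)
predecessor-unique (_ ∷ u) (there c) (there d) = predecessor-unique u c d

-- Subsets of a finite vertex set

select : {P : Pred (Fin n) 0ℓ} → Unary.Decidable P → Subset n
select P? = tabulate (λ v → does (P? v))

module _ {P : Pred (Fin n) 0ℓ} (P? : Unary.Decidable P) where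

  ∈-select⁺ : ∀ {v} → P v → v ∈ˢ select P?
  ∈-select⁺ {v} Pv =
    lookup⇒[]= v _ (trans (lookup∘tabulate _ v) (dec-true (P? v) Pv))

  ∈-select⁻ : ∀ {v} → v ∈ˢ select P? → P v
  ∈-select⁻ {v} v∈ with P? v | trans (sym (lookup∘tabulate (does ∘ P?) v)) ([]=⇒lookup v∈)
  ... | yes Pv | _ = Pv

∣⁅x⁆∪p∣≤1+∣p∣ : ∀ (x : Fin n) p → ∣ ⁅ x ⁆ ∪ p ∣ ≤ suc ∣ p ∣
∣⁅x⁆∪p∣≤1+∣p∣ zero (s ∷ p) rewrite Subset.∪-identityˡ p = s≤s (Subset.∣p∣≤∣x∷p∣ s p)
∣⁅x⁆∪p∣≤1+∣p∣ (suc x) (inside  ∷ p) = s≤s (∣⁅x⁆∪p∣≤1+∣p∣ x p)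
∣⁅x⁆∪p∣≤1+∣p∣ (suc x) (outside ∷ p) = ∣⁅x⁆∪p∣≤1+∣p∣ x p

∣⁅x⁆∪⁅y⁆∣≡2 : ∀ {x y : Fin n} → x ≢ y → ∣ ⁅ x ⁆ ∪ ⁅ y ⁆ ∣ ≡ 2
∣⁅x⁆∪⁅y⁆∣≡2 {x = zero}  {zero}  x≢y = contradiction refl x≢y
∣⁅x⁆∪⁅y⁆∣≡2 {x = zero}  {suc y} x≢y
  rewrite Subset.∪-identityˡ ⁅ y ⁆ = cong suc (Subset.∣⁅x⁆∣≡1 y)
∣⁅x⁆∪⁅y⁆∣≡2 {x = suc x} {zero}  x≢y
  rewrite Subset.∪-identityʳ ⁅ x ⁆ = cong suc (Subset.∣⁅x⁆∣≡1 x)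
∣⁅x⁆∪⁅y⁆∣≡2 {x = suc x} {suc y} x≢y = ∣⁅x⁆∪⁅y⁆∣≡2 (x≢y ∘ cong suc)

⟨_⟩ : List (Fin n) → Subset n
⟨ [] ⟩     = ∅
⟨ v ∷ vs ⟩ = ⁅ v ⁆ ∪ ⟨ vs ⟩

∣⟨vs⟩∣≤length : (vs : List (Fin n)) → ∣ ⟨ vs ⟩ ∣ ≤ length vs
∣⟨vs⟩∣≤length {n} [] = ℕ.≤-reflexive (Subset.∣⊥∣≡0 n)
∣⟨vs⟩∣≤length (v ∷ vs) =
  ℕ.≤-trans (∣⁅x⁆∪p∣≤1+∣p∣ v ⟨ vs ⟩) (s≤s (∣⟨vs⟩∣≤length vs))

∈⇒∈⟨⟩ : ∀ {v} {vs : List (Fin n)} → v ∈ vs → v ∈ˢ ⟨ vs ⟩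
∈⇒∈⟨⟩ (here refl) = Subset.x∈p∪q⁺ (inj₁ (Subset.x∈⁅x⁆ _))
∈⇒∈⟨⟩ (there v∈)  = Subset.x∈p∪q⁺ (inj₂ (∈⇒∈⟨⟩ v∈))

-- The set `⟨ vs ⟩` has at most `length vs` elements, too few to contain all of `S`.
fresh-element : ∀ {S : Subset n} vs → length vs < ∣ S ∣ → ∃[ v ] v ∈ˢ S × v ∉ vs
fresh-element {S = S} vs len< with any? (λ v → (v Subset.∈? S) ×-dec ¬? (v Subset.∈? ⟨ vs ⟩))
... | yes (v , v∈ , v∉) = v , v∈ , v∉ ∘ ∈⇒∈⟨⟩
... | no none = contradiction
  (Subset.p⊆q⇒∣p∣≤∣q∣ λ {v} v∈ → decidable-stable (v Subset.∈? ⟨ vs ⟩) λ v∉ → none (v , v∈ , v∉))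
  (ℕ.<⇒≱ (ℕ.≤-<-trans (∣⟨vs⟩∣≤length vs) len<))

-- Walks and paths

private
  _∈?_ : (v : Fin n) (vs : List (Fin n)) → Dec (v ∈ vs)
  _∈?_ = DecMembership._∈?_ _≟_

Inside : Graph n → Pred (Fin n) 0ℓ → Rel (Fin n) 0ℓ
Inside G P x y = x ~ y × P x × P y
  where open Graph G

restrict : (G : Graph n) {P : Pred (Fin n) 0ℓ} → Unary.Decidable P → Graph n
restrict G {P} P? = record
  { _~_    = Inside G P
  ; _~?_   = λ x y → (x ~? y) ×-dec (P? x ×-dec P? y)
  ; sym    = λ (e , Px , Py) → symᴳ e , Py , Px
  ; irrefl = λ eq (e , _) → irrefl eq e
  } where open Graph G renaming (sym to symᴳ)

delete : Graph n → Fin n → Fin n → Graph n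
delete G a b = record
  { _~_    = λ x y → x ~ y × ¬ (x ≡ a × y ≡ b) × ¬ (x ≡ b × y ≡ a)
  ; _~?_   = λ x y → (x ~? y) ×-dec (¬? ((x ≟ a) ×-dec (y ≟ b)) ×-dec ¬? ((x ≟ b) ×-dec (y ≟ a)))
  ; sym    = λ (e , ¬ab , ¬ba) → symᴳ e , ¬ba ∘ swap , ¬ab ∘ swap
  ; irrefl = λ eq (e , _) → irrefl eq e
  } where open Graph G renaming (sym to symᴳ)

module _ {G : Graph n} where
  open Graph G renaming (sym to ~-sym)
  private variable
    a b c d u v w : Fin n
    vs ws : List (Fin n)

  walk-start : Walk G u v vs → u ∈ vs
  walk-start stop       = here refl
  walk-start (step _ _) = here refl

  walk-end : Walk G u v vs → v ∈ vs
  walk-end stop       = here refl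
  walk-end (step _ W) = there (walk-end W)

  suffix : Path G u v vs → w ∈ vs → ∃[ ws ] Path G w v ws × ws ⊆ vs
  suffix P@(stop , _)     (here refl) = _ , P , id
  suffix P@(step _ _ , _) (here refl) = _ , P , id
  suffix (step _ W , uniq) (there w∈) with suffix (W , Unique-tail uniq) w∈
  ... | ws , Q , ws⊆vs = ws , Q , there ∘ ws⊆vs

  -- If `w` already lies on the path, the suffix from `w` serves, so no repetition arises. This is
  -- the step that turns walks into paths.
  prepend : w ~ u → Path G u v vs → ∃[ ws ] Path G w v ws × ws ⊆ w ∷ vs
  prepend {w} {vs = vs} e P@(W , uniq) with w ∈? vs
  ... | no w∉ = _ , (step e W , Unique-∷ w∉ uniq) , id
  ... | yes w∈ with suffix P w∈
  ...   | ws , Q , ws⊆vs = ws , Q , there ∘ ws⊆vs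

  connected⇒path : {P : Pred (Fin n) 0ℓ} → P u → Star (Inside G P) u v →
    ∃[ vs ] Path G u v vs × All P vs
  connected⇒path Pu ε = _ , (stop , [] ∷ []) , Pu ∷ []
  connected⇒path Pu ((e , _ , Pv) ◅ R) with connected⇒path Pv R
  ... | vs , Q , Pvs with prepend e Q
  ...   | ws , Q′ , ws⊆ = ws , Q′ , anti-mono ws⊆ (Pu ∷ Pvs)

  walk⇒connected : {P : Pred (Fin n) 0ℓ} → Walk G u v vs → All P vs → Star (Inside G P) u v
  walk⇒connected stop _ = ε
  walk⇒connected (step e W) (Pu ∷ Pvs) =
    (e , Pu , All.lookup Pvs (walk-start W)) ◅ walk⇒connected W Pvs

  -- The path obtained is the reverse of vs followed by ws.
  splice : Path G a c vs → Path G b d ws → a ~ b → Disjoint vs ws →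
    ∃[ us ] Path G c d us × ws ⊆ us
  splice (stop , _) (W , uniq) e disj =
    _ , (step e W , Unique-∷ (λ a∈ws → disj (here refl , a∈ws)) uniq) , there
  splice (step f V , uniqV) (W , uniqW) e disj
    with splice (V , Unique-tail uniqV)
           (step e W , Unique-∷ (λ a∈ws → disj (here refl , a∈ws)) uniqW) (~-sym f)
           (λ { (v∈ , here refl) → Unique-head uniqV v∈ ; (v∈ , there v∈ws) → disj (there v∈ , v∈ws) })
  ... | us , P , ws⊆ = us , P , ws⊆ ∘ there

  drop-end : Path G u v vs → u ≢ v → ∃[ w ] ∃[ ws ] Path G u w ws × ws ⊆ vs × v ∉ ws × w ~ v
  drop-end (stop , _) u≢v = contradiction refl u≢v
  drop-end {v = v} (step {v = x} e W , uniq) u≢v with x ≟ v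
  ... | yes refl =
    _ , _ , (stop , [] ∷ []) , (λ { (here refl) → here refl }) , (λ { (here refl) → u≢v refl }) , e
  ... | no x≢v with drop-end (W , Unique-tail uniq) x≢v
  ...   | w , ws , (W′ , uniq′) , ws⊆ , v∉ , w~v =
    w , _ , (step e W′ , Unique-∷ (Unique-head uniq ∘ ws⊆) uniq′) ,
    (λ { (here refl) → here refl ; (there y∈) → there (ws⊆ y∈) }) ,
    (λ { (here refl) → u≢v refl ; (there v∈) → v∉ v∈ }) , w~v

  closed-walk-edge : Walk G u v vs → w ~ u → Consecutive (w ∷ vs) x y → x ~ y
  closed-walk-edge stop       e here      = e
  closed-walk-edge (step _ _) e here      = e
  closed-walk-edge stop       e (there (there ()))
  closed-walk-edge (step f W) e (there c) = closed-walk-edge W f c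

  -- `Q` bounds where the walk may go, so `P` has to survive only steps into `Q`. In the application
  -- `Q` is the complement of a cutset.
  walk-preserves : {P Q : Pred (Fin n) 0ℓ} → (∀ {x y} → x ~ y → P x → Q y → P y) →
    Walk G u v vs → All Q vs → P u → P v
  walk-preserves closed stop _ Pu = Pu
  walk-preserves closed (step e W) (_ ∷ Qvs) Pu =
    walk-preserves closed W Qvs (closed e Pu (All.lookup Qvs (walk-start W)))

  -- Reachability in exactly `k` steps is decidable by recursion on `k`; a bound on `k` then makes
  -- `Star` decidable.
  Steps : ℕ → Rel (Fin n) 0ℓ
  Steps zero    u v = u ≡ v
  Steps (suc k) u v = ∃[ w ] u ~ w × Steps k w v

  steps? : ∀ k → Decidable (Steps k)
  steps? zero    u v = u ≟ v
  steps? (suc k) u v = any? λ w → (u ~? w) ×-dec steps? k w v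

  steps⇒connected : ∀ k → Steps k u v → Star _~_ u v
  steps⇒connected zero    refl        = ε
  steps⇒connected (suc k) (_ , e , S) = e ◅ steps⇒connected k S

  walk⇒steps : Walk G u v vs → ∃[ k ] suc k ≡ length vs × Steps k u v
  walk⇒steps stop = 0 , refl , refl
  walk⇒steps (step e W) with walk⇒steps W
  ... | k , eq , S = suc k , cong suc eq , _ , e , S

  connected? : Decidable (Star _~_)
  connected? u v = map′ (λ (k , _ , S) → steps⇒connected k S) shorten
                        (ℕ.anyUpTo? (λ k → steps? k u v) n)
    where
    shorten : Star _~_ u v → ∃[ k ] k < n × Steps k u v
    -- A path repeats no vertex, so it has at most `n` vertices and fewer than `n` steps.
    shorten R with connected⇒path {P = λ _ → ⊤} tt (Star.map (_, tt , tt) R)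
    ... | vs , (W , uniq) , _ with walk⇒steps W
    ...   | k , eq , S = k , ℕ.≤-trans (ℕ.≤-reflexive eq) (Unique⇒length≤n uniq) , S

connectedInside? : (G : Graph n) {P : Pred (Fin n) 0ℓ} → Unary.Decidable P →
  Decidable (Star (Inside G P))
connectedInside? G P? = connected? {G = restrict G P?}

-- Chords of cycles

module _ (G : Graph n) (chordless : Chordless G) {a b : Fin n} (a~b : Graph._~_ G a b) where
  open Graph G

  private
    H : Graph n
    H = delete G a b

  -- A cycle of `H` is a cycle of `G`. With `a` and `b` on it, chordlessness would make `ab` one of
  -- its cycle edges, and these all lie in `H`.
  ¬cycle-through-deleted-edge : ∀ {c d vs} → Path H c d vs → Graph._~_ H d c →
    a ∈ vs → b ∈ vs → ⊥
  ¬cycle-through-deleted-edge {c} {d} {vs} (W , uniq) d~c a∈ b∈ = not-in-H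
    (SymClosure.fold (Graph.sym H) (closed-walk-edge W d~c)
      (chordless c d vs ((forget W , uniq) , long W d~c a∈ b∈ , proj₁ d~c) a b a∈ b∈ a~b))
    where
    not-in-H : ¬ Graph._~_ H a b
    not-in-H (_ , ¬ab , _) = ¬ab (refl , refl)

    forget : ∀ {u v us} → Walk H u v us → Walk G u v us
    forget stop            = stop
    forget (step (e , _) V) = step e (forget V)

    long : ∀ {u v us} → Walk H u v us → Graph._~_ H v u → a ∈ us → b ∈ us → 3 ≤ length us
    long stop (e , _) _ _ = contradiction e (irrefl refl)
    long (step _ stop) e (here refl) (here refl) = contradiction a~b (irrefl refl)
    -- If `a` and `b` were the only vertices, the closing edge would be `ab` itself, which `H`
    -- lacks.
    long (step _ stop) e (here refl) (there (here refl)) = contradiction (Graph.sym H e) not-in-H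
    long (step _ stop) e (there (here refl)) (here refl) = contradiction e not-in-H
    long (step _ stop) e (there (here refl)) (there (here refl)) = contradiction a~b (irrefl refl)
    long (step _ (step _ V)) _ _ _ = s≤s (s≤s (nonempty V))
      where
      nonempty : ∀ {u v us} → Walk H u v us → 1 ≤ length us
      nonempty stop       = s≤s z≤n
      nonempty (step _ _) = s≤s z≤n

-- Two internally disjoint paths

module _ (H : Graph n) (u : Fin n) where
  open Graph H renaming (sym to ~-sym)

  MeetOnlyAtEnd : Rel (List (Fin n)) 0ℓ
  MeetOnlyAtEnd ps qs = ∀ {x} → x ∈ ps → x ∈ qs → x ≡ u

  -- Two internally disjoint paths w ∷ ps and w ∷ qs from w to u; they may
  -- coincide when w is a neighbour of u.
  record Fan (w : Fin n) : Set where
    field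
      {p q}   : Fin n
      {ps qs} : List (Fin n)
      w~p     : w ~ p
      w~q     : w ~ q
      p⇝u     : Path H p u ps
      q⇝u     : Path H q u qs
      w∉ps    : w ∉ ps
      w∉qs    : w ∉ qs
      meet    : MeetOnlyAtEnd ps qs

  swapFan : ∀ {w} → Fan w → Fan w
  swapFan F = record
    { w~p = w~q ; w~q = w~p ; p⇝u = q⇝u ; q⇝u = p⇝u
    ; w∉ps = w∉qs ; w∉qs = w∉ps ; meet = λ x∈qs x∈ps → meet x∈ps x∈qs }
    where open Fan F

  -- The walk is followed to its first vertex on `ps` or `qs`, and from there that path is followed
  -- to `u`. The result can meet the other path only at `u`, which decides the alternative.
  evade : ∀ {w z} (F : Fan w) → z ≢ w → Star (Inside H (_≢ w)) z u →
    ∃[ vs ] Path H z u vs × w ∉ vs × (MeetOnlyAtEnd vs (Fan.qs F) ⊎ MeetOnlyAtEnd vs (Fan.ps F))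
  evade {w} {z} F z≢w R = go z≢w R
    where
    open Fan F
    go : ∀ {z} → z ≢ w → Star (Inside H (_≢ w)) z u →
      ∃[ vs ] Path H z u vs × w ∉ vs × (MeetOnlyAtEnd vs qs ⊎ MeetOnlyAtEnd vs ps)
    go {z} z≢w R with z ∈? ps | z ∈? qs
    go z≢w R | yes z∈ps | _ with suffix p⇝u z∈ps
    ... | vs , P , vs⊆ps = vs , P , w∉ps ∘ vs⊆ps , inj₁ (meet ∘ vs⊆ps)
    go z≢w R | _ | yes z∈qs with suffix q⇝u z∈qs
    ... | vs , P , vs⊆qs = vs , P , w∉qs ∘ vs⊆qs , inj₂ λ x∈vs x∈ps → meet x∈ps (vs⊆qs x∈vs)
    -- The end `u` lies on `ps`, so the walk cannot finish without hitting a path.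
    go z≢w ε | no z∉ps | _ = contradiction (walk-end (proj₁ p⇝u)) z∉ps
    go {z} z≢w ((e , _ , y≢w) ◅ R) | no z∉ps | no z∉qs with go y≢w R
    ... | vs , P , w∉vs , meets with prepend e P
    ...   | vs′ , P′ , vs′⊆ =
      vs′ , P′ ,
      (λ w∈ → [ (λ w≡z → z≢w (sym w≡z)) , w∉vs ]′ (uncons (vs′⊆ w∈))) ,
      Sum.map (extend z∉qs) (extend z∉ps) meets
      where
      uncons : ∀ {x} → x ∈ z ∷ vs → x ≡ z ⊎ x ∈ vs
      uncons (here eq)  = inj₁ eq
      uncons (there x∈) = inj₂ x∈
      extend : ∀ {ts} → z ∉ ts → MeetOnlyAtEnd vs ts → MeetOnlyAtEnd vs′ ts
      extend z∉ts meet′ x∈ x∈ts with vs′⊆ x∈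
      ... | here refl = contradiction x∈ts z∉ts
      ... | there x∈vs = meet′ x∈vs x∈ts

  -- The new paths are `vs` without its start `z`, and `w` followed by the old `qs`. They meet only
  -- at `u` because `vs` avoids `w`.
  extendFan : ∀ {w z} (F : Fan w) → z ~ w → z ≢ u →
    ∀ {vs} → Path H z u vs → w ∉ vs → MeetOnlyAtEnd vs (Fan.qs F) → Fan z
  extendFan F z~w z≢u (stop , _) _ _ = contradiction refl z≢u
  extendFan {w} F z~w z≢u (step e W , uniq) w∉ meets = record
    { w~p    = e
    ; w~q    = z~w
    ; p⇝u    = W , Unique-tail uniq
    ; q⇝u    = step w~q (proj₁ q⇝u) , Unique-∷ w∉qs (proj₂ q⇝u)
    ; w∉ps   = Unique-head uniq
    ; w∉qs   = λ { (here refl) → w∉ (here refl) ; (there z∈qs) → z≢u (meets (here refl) z∈qs) }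
    ; meet   = λ { x∈ (here refl)  → contradiction (there x∈) w∉
                 ; x∈ (there x∈qs) → meets (there x∈) x∈qs }
    }
    where open Fan F

  module _ (avoidable : ∀ w → w ≢ u → ∀ z → z ≢ w → Star (Inside H (_≢ w)) z u) where

    -- Induction along the walk to `u`. At a neighbour of `u` both paths are the single edge to `u`.
    fan : ∀ {w} → w ≢ u → Star _~_ w u → Fan w
    fan w≢u ε = contradiction refl w≢u
    fan {z} z≢u (_◅_ {j = w} e R) with w ≟ u
    ... | yes refl = record
      { w~p = e ; w~q = e ; p⇝u = stop , [] ∷ [] ; q⇝u = stop , [] ∷ []
      ; w∉ps = λ { (here eq) → z≢u eq } ; w∉qs = λ { (here eq) → z≢u eq }
      ; meet = λ { (here eq) _ → eq } }
    ... | no w≢u = grow (fan w≢u R)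
      where
      z≢w : z ≢ w
      z≢w eq = irrefl eq e
      grow : Fan w → Fan z
      grow F with evade F z≢w (avoidable w w≢u z z≢w)
      ... | vs , P , w∉vs , inj₁ meets = extendFan F e z≢u P w∉vs meets
      -- The detour has merged into `qs`, so `ps` is the path to keep and extend.
      ... | vs , P , w∉vs , inj₂ meets = extendFan (swapFan F) e z≢u P w∉vs meets

  -- Both paths contain `u`, so it is dropped from the second before they are joined through `v`;
  -- the edge lost becomes the closing edge. As `v` is not adjacent to `u`, the second path has a
  -- vertex left.
  fan⇒cycle : ∀ {v} → ¬ v ~ u → Fan v →
    ∃[ w ] ∃[ vs ] Path H u w vs × w ~ u × u ∈ vs × v ∈ vs
  fan⇒cycle v≁u F with drop-end q⇝u (λ { refl → v≁u w~q })
    where open Fan F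
  ... | w , ws , (W , uniq) , ws⊆ , u∉ws , w~u
    with splice p⇝u (step w~q W , Unique-∷ (w∉qs ∘ ws⊆) uniq) (~-sym w~p)
      (λ { (x∈ps , here refl) → w∉ps x∈ps
         ; (x∈ps , there x∈ws) → u∉ws (subst (_∈ ws) (meet x∈ps (ws⊆ x∈ws)) x∈ws) })
    where open Fan F
  ...   | us , P , ws⊆us = w , us , P , w~u , walk-start (proj₁ P) , ws⊆us (here refl)

-- Cutsets

module _ (G : Graph n) where
  open Graph G renaming (sym to ~-sym)

  fresh-neighbour : ∀ {u} vs → length vs < deg G u → ∃[ w ] u ~ w × w ∉ vs
  fresh-neighbour {u} vs len< with fresh-element vs len<
  -- `neighbours G u` unfolds to `select (u ~?_)`.
  ... | w , w∈ , w∉ = w , ∈-select⁻ (u ~?_) w∈ , w∉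

  -- The first vertex of a path has no predecessor, so each path edge at it leads to its only
  -- successor.
  path-start-edge-unique : ∀ {a b vs y z} → Path G a b vs →
    PathEdge G vs a y → PathEdge G vs a z → y ≡ z
  path-start-edge-unique (W , uniq) e f = successor-unique uniq (forward W uniq e) (forward W uniq f)
    where
    forward : ∀ {a b vs y} → Walk G a b vs → Unique vs → PathEdge G vs a y → Consecutive vs a y
    forward _          _    (fwd c) = c
    forward stop       _    (bwd c) = contradiction (Consecutive⇒∈ʳ c) λ ()
    forward (step _ _) uniq (bwd c) = contradiction (Consecutive⇒∈ʳ c) (Unique-head uniq)

  -- Without repetition a vertex has at most one successor and one predecessor, so among any three
  -- neighbours joined to it by path edges two coincide.
  deg≤2-of-path-edges : ∀ {vs : List (Fin n)} {w} → Unique vs →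
    (∀ x → w ~ x → PathEdge G vs w x) → deg G w ≤ 2
  deg≤2-of-path-edges {vs} {w} uniq edge = ℕ.≮⇒≥ λ 3≤deg →
    let x , w~x , _  = fresh-neighbour [] (ℕ.<⇒≤ (ℕ.<⇒≤ 3≤deg))
        y , w~y , y∉ = fresh-neighbour (x ∷ []) (ℕ.<⇒≤ 3≤deg)
        z , w~z , z∉ = fresh-neighbour (x ∷ y ∷ []) 3≤deg
    in [ (λ x≡y → y∉ (here (sym x≡y)))
       , [ (λ x≡z → z∉ (here (sym x≡z))) , (λ y≡z → z∉ (there (here (sym y≡z)))) ]′
       ]′ (pigeonhole (edge x w~x) (edge y w~y) (edge z w~z))
    where
    pigeonhole : ∀ {x y z} →
      PathEdge G vs w x → PathEdge G vs w y → PathEdge G vs w z → x ≡ y ⊎ x ≡ z ⊎ y ≡ z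
    pigeonhole (fwd c) (fwd d) _       = inj₁ (successor-unique uniq c d)
    pigeonhole (bwd c) (bwd d) _       = inj₁ (predecessor-unique uniq c d)
    pigeonhole (fwd c) (bwd _) (fwd d) = inj₂ (inj₁ (successor-unique uniq c d))
    pigeonhole (fwd _) (bwd c) (bwd d) = inj₂ (inj₂ (predecessor-unique uniq c d))
    pigeonhole (bwd _) (fwd c) (fwd d) = inj₂ (inj₂ (successor-unique uniq c d))
    pigeonhole (bwd c) (fwd _) (bwd d) = inj₂ (inj₁ (predecessor-unique uniq c d))

-- The edge uv is a bridge of G − x, with U and V the two sides.
record Bridge (G : Graph n) (x u v : Fin n) : Set₁ where
  open Graph G
  field
    U V      : Pred (Fin n) 0ℓ
    U?       : Unary.Decidable U
    V?       : Unary.Decidable V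
    u∈U      : U u
    v∈V      : V v
    x∉U      : ¬ U x
    x∉V      : ¬ V x
    disjoint : ∀ {z} → U z → ¬ V z
    cover    : ∀ z → z ≢ x → U z ⊎ V z
    bridge   : ∀ {y z} → y ~ z → U y → V z → y ≡ u × z ≡ v

swapBridge : ∀ {G : Graph n} {x u v} → Bridge G x u v → Bridge G x v u
swapBridge {G = G} B = record
  { U = V ; V = U ; U? = V? ; V? = U? ; u∈U = v∈V ; v∈V = u∈U ; x∉U = x∉V ; x∉V = x∉U
  ; disjoint = λ Vz Uz → disjoint Uz Vz
  ; cover    = λ z z≢x → Sum.swap (cover z z≢x)
  ; bridge   = λ e Vy Uz → swap (bridge (Graph.sym G e) Uz Vy)
  } where open Bridge B

-- Consequences of a bridge in a vertex-deleted graph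

module _ {G : Graph n} {x u v : Fin n} (B : Bridge G x u v) where
  open Graph G renaming (sym to ~-sym)
  open Bridge B

  private
    u≢x : u ≢ x
    u≢x refl = x∉U u∈U

    v≢x : v ≢ x
    v≢x refl = x∉V v∈V

    v≢u : v ≢ u
    v≢u refl = disjoint u∈U v∈V

    neighbour-in-U : ∀ {y} → u ~ y → y ≢ x → y ≢ v → U y
    neighbour-in-U {y} e y≢x y≢v with cover y y≢x
    ... | inj₁ Uy = Uy
    ... | inj₂ Vy = contradiction (proj₂ (bridge e u∈U Vy)) y≢v

  bridge⇒proper2Cutset : 3 ≤ deg G u → 3 ≤ deg G v → ¬ u ~ x → IsProper2Cutset G u x
  bridge⇒proper2Cutset 3≤deg-u 3≤deg-v u≁x
    -- Neighbours of `u` other than `v` lie in `U`, because `x` is not adjacent to `u` and `uv` is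
    -- the only edge from `u` into `V`.
    with fresh-neighbour G (v ∷ []) (ℕ.<⇒≤ 3≤deg-u)
  ... | y , u~y , y∉
    with fresh-neighbour G (v ∷ y ∷ []) 3≤deg-u
  ... | z , u~z , z∉ =
    (∣⁅x⁆∪⁅y⁆∣≡2 u≢x , disconnected) , u≁x , X , Y ,
    (y , ∈-select⁺ X? y∈X) , (v , ∈-select⁺ V? v∈V) ,
    (λ (w , w∈) → uncurry (λ w∈X w∈Y → disjoint (proj₁ (∈-select⁻ X? w∈X)) (∈-select⁻ V? w∈Y))
                          (Subset.x∈p∩q⁻ X Y w∈)) ,
    Subset.⊆-antisym X∪Y⊆ ⊆X∪Y ,
    (λ s t s∈X t∈Y s~t → proj₂ (∈-select⁻ X? s∈X)
      (proj₁ (bridge s~t (proj₁ (∈-select⁻ X? s∈X)) (∈-select⁻ V? t∈Y)))) ,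
    X-not-path , Y-not-path
    where
    -- Taking `u` out of `U` and into the cutset also removes the only edge between the sides.
    X? = U? ∩? ∁? (_≟ u)
    X = select X?
    Y = select V?
    C = ⁅ u ⁆ ∪ ⁅ x ⁆

    u∈C : u ∈ˢ C
    u∈C = Subset.x∈p∪q⁺ (inj₁ (Subset.x∈⁅x⁆ u))

    x∈C : x ∈ˢ C
    x∈C = Subset.x∈p∪q⁺ (inj₂ (Subset.x∈⁅x⁆ x))

    ∈∁C⁺ : ∀ {w} → w ≢ u → w ≢ x → w ∈ˢ ∁ C
    ∈∁C⁺ w≢u w≢x = Subset.x∉p⇒x∈∁p λ w∈C →
      [ w≢u ∘ Subset.x∈⁅y⁆⇒x≡y u , w≢x ∘ Subset.x∈⁅y⁆⇒x≡y x ]′ (Subset.x∈p∪q⁻ ⁅ u ⁆ ⁅ x ⁆ w∈C)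

    ∈∁C⁻ : ∀ {w} → w ∈ˢ ∁ C → w ≢ u × w ≢ x
    ∈∁C⁻ w∈ = (λ { refl → Subset.x∈∁p⇒x∉p w∈ u∈C }) , (λ { refl → Subset.x∈∁p⇒x∉p w∈ x∈C })

    away-from-u : ∀ {w} → u ~ w → w ∉ v ∷ [] → U w × w ≢ u
    away-from-u {w} u~w w∉ =
      neighbour-in-U u~w (λ { refl → u≁x u~w }) (λ w≡v → w∉ (here w≡v)) ,
      λ { refl → irrefl refl u~w }

    y∈X : U y × y ≢ u
    y∈X = away-from-u u~y y∉

    z∈X : U z × z ≢ u
    z∈X = away-from-u u~z λ { (here z≡v) → z∉ (here z≡v) }

    disconnected : ¬ ConnectedOn G (∁ C)
    disconnected conn
      with conn y v (∈∁C⁺ (proj₂ y∈X) (λ { refl → x∉U (proj₁ y∈X) })) (∈∁C⁺ v≢u v≢x)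
    ... | vs , (W , _) , vs⊆∁C = disjoint (proj₁ (walk-preserves stays W vs⊆∁C y∈X)) v∈V
      where
      stays : ∀ {s t} → s ~ t → U s × s ≢ u → t ∈ˢ ∁ C → U t × t ≢ u
      stays {t = t} s~t (Us , s≢u) t∈ with ∈∁C⁻ t∈
      ... | t≢u , t≢x with cover t t≢x
      ...   | inj₁ Ut = Ut , t≢u
      ...   | inj₂ Vt = contradiction (proj₁ (bridge s~t Us Vt)) s≢u

    X∪Y⊆ : ∀ {w} → w ∈ˢ X ∪ Y → w ∈ˢ ∁ C
    X∪Y⊆ w∈ with Subset.x∈p∪q⁻ X Y w∈
    ... | inj₁ w∈X = ∈∁C⁺ (proj₂ (∈-select⁻ X? w∈X)) λ { refl → x∉U (proj₁ (∈-select⁻ X? w∈X)) }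
    ... | inj₂ w∈Y = ∈∁C⁺ (λ { refl → disjoint u∈U (∈-select⁻ V? w∈Y) })
                          (λ { refl → x∉V (∈-select⁻ V? w∈Y) })

    ⊆X∪Y : ∀ {w} → w ∈ˢ ∁ C → w ∈ˢ X ∪ Y
    ⊆X∪Y {w} w∈ with ∈∁C⁻ w∈
    ... | w≢u , w≢x with cover w w≢x
    ...   | inj₁ Uw = Subset.x∈p∪q⁺ (inj₁ (∈-select⁺ X? (Uw , w≢u)))
    ...   | inj₂ Vw = Subset.x∈p∪q⁺ (inj₂ (∈-select⁺ V? Vw))

    X-not-path : ¬ IsPathOn G (X ∪ C) u x
    X-not-path (vs , P , vs≗ , induced) =
      z∉ (there (here (path-start-edge-unique G P (edge u~z z∈X) (edge u~y y∈X))))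
      where
      edge : ∀ {w} → u ~ w → U w × w ≢ u → PathEdge G vs u w
      edge u~w w∈X = induced _ _
        (Equivalence.from (vs≗ _) (Subset.x∈p∪q⁺ (inj₂ u∈C)))
        (Equivalence.from (vs≗ _) (Subset.x∈p∪q⁺ (inj₁ (∈-select⁺ X? w∈X)))) u~w

    Y-not-path : ¬ IsPathOn G (Y ∪ C) u x
    Y-not-path (vs , (_ , uniq) , vs≗ , induced) =
      ℕ.<⇒≱ 3≤deg-v (deg≤2-of-path-edges G uniq λ w v~w → induced v w
        (Equivalence.from (vs≗ v) (Subset.x∈p∪q⁺ (inj₁ (∈-select⁺ V? v∈V))))
        (Equivalence.from (vs≗ w) (in-Y∪C v~w)) v~w)
      where
      in-Y∪C : ∀ {w} → v ~ w → w ∈ˢ Y ∪ C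
      in-Y∪C {w} v~w with w ≟ x
      ... | yes refl = Subset.x∈p∪q⁺ (inj₂ x∈C)
      ... | no w≢x with cover w w≢x
      ...   | inj₂ Vw = Subset.x∈p∪q⁺ (inj₁ (∈-select⁺ V? Vw))
      -- The only neighbour of `v` across the bridge is `u`, which belongs to `C`.
      ...   | inj₁ Uw with bridge (~-sym v~w) Uw v∈V
      ...     | refl , _ = Subset.x∈p∪q⁺ (inj₂ u∈C)

  private
    -- The edge `ux` is to be the chord, so the cycle is built in the graph without it.
    Gᵤₓ : Graph n
    Gᵤₓ = delete G u x

    UpToX : Pred (Fin n) 0ℓ
    UpToX w = w ≢ u × (U w ⊎ w ≡ x)

    -- The walk is cut at its first arrival at `x`. Until then it stays in `U`, since the only edge
    -- into `V` starts at `u`; avoiding `u` also keeps it off the deleted edge.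
    stop-at-x : ∀ {z} → Star (Inside G (_≢ u)) z x → U z → Star (Inside Gᵤₓ UpToX) z x
    stop-at-x ε Ux = contradiction Ux x∉U
    stop-at-x (_◅_ {j = w} (z~w , z≢u , w≢u) R) Uz with w ≟ x
    ... | yes refl =
      ((z~w , z≢u ∘ proj₁ , w≢u ∘ proj₂) , (z≢u , inj₁ Uz) , (w≢u , inj₂ refl)) ◅ ε
    ... | no w≢x with cover w w≢x
    ...   | inj₁ Uw =
      ((z~w , z≢u ∘ proj₁ , w≢u ∘ proj₂) , (z≢u , inj₁ Uz) , (w≢u , inj₁ Uw)) ◅ stop-at-x R Uw
    ...   | inj₂ Vw = contradiction (proj₁ (bridge z~w Uz Vw)) z≢u

    ¬detour : Chordless G → u ~ v → u ~ x → x ~ v →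
      ∀ {y vs} → u ~ y → y ≢ x → Path Gᵤₓ y x vs → All UpToX vs → ⊥
    ¬detour chordless u~v u~x x~v {vs = vs} u~y y≢x (W , uniq) vs⊆ =
      ¬cycle-through-deleted-edge G chordless u~x
        -- The cycle runs from `v` to `u` to `y`, then along `vs` to `x`, and closes with `x~v`. Its
        -- edge `uy` differs from the deleted one because `y ≢ x`.
        (step v~u (step (u~y , y≢x ∘ proj₂ , u≢x ∘ proj₁) W) , Unique-∷ v∉ (Unique-∷ u∉vs uniq))
        (x~v , v≢x ∘ proj₂ , v≢u ∘ proj₂)
        (there (here refl)) (there (there (walk-end W)))
      where
      v~u : Graph._~_ Gᵤₓ v u
      v~u = ~-sym u~v , v≢u ∘ proj₁ , v≢x ∘ proj₁

      u∉vs : u ∉ vs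
      u∉vs u∈ = proj₁ (All.lookup vs⊆ u∈) refl

      v∉ : v ∉ u ∷ vs
      v∉ (here v≡u) = v≢u v≡u
      v∉ (there v∈) = [ (λ Uv → disjoint Uv v∈V) , v≢x ]′ (proj₂ (All.lookup vs⊆ v∈))

  -- A path from a neighbour of u in U to x, closed up by v and u, has the chord ux.
  ¬bridge-in-triangle : Chordless G → 3 ≤ deg G u → u ~ v → u ~ x → x ~ v →
    (∀ y → y ≢ u → Star (Inside G (_≢ u)) y x) → ⊥
  ¬bridge-in-triangle chordless 3≤deg-u u~v u~x x~v reach-x =
    let y , u~y , y∉ = fresh-neighbour G (v ∷ x ∷ []) 3≤deg-u
        y≢x = λ (y≡x : y ≡ x) → y∉ (there (here y≡x))
        y≢u = λ (y≡u : y ≡ u) → irrefl (sym y≡u) u~y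
        Uy  = neighbour-in-U u~y y≢x λ y≡v → y∉ (here y≡v)
        vs , P , vs⊆ = connected⇒path (y≢u , inj₁ Uy) (stop-at-x (reach-x y y≢u) Uy)
    in ¬detour chordless u~v u~x x~v u~y y≢x P vs⊆

-- Biconnectedness and 1-cutsets

module _ (G : Graph n) where

  ConnectedWithout : Pred (Fin n) 0ℓ
  ConnectedWithout x = ∀ a b → a ≢ x → b ≢ x → Star (Inside G (_≢ x)) a b

  -- Only vertex-deleted graphs are asked to be connected, to oppose having a 1-cutset; two isolated
  -- vertices qualify.
  Biconnected : Set
  Biconnected = ∀ x → ConnectedWithout x

  connectedWithout? : Unary.Decidable ConnectedWithout
  connectedWithout? x = all? λ a → all? λ b →
    ¬? (a ≟ x) →-dec (¬? (b ≟ x) →-dec connectedInside? G (∁? (_≟ x)) a b)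

  ¬connectedWithout⇒1-cutset : ∀ {x} → ¬ ConnectedWithout x → IsCutset G 1 ⁅ x ⁆
  ¬connectedWithout⇒1-cutset {x} ¬connₓ = Subset.∣⁅x⁆∣≡1 x , λ conn → ¬connₓ λ a b a≢x b≢x →
    let vs , (W , _) , vs⊆ = conn a b (outside-x a≢x) (outside-x b≢x)
    in walk⇒connected W (All.map (Subset.x∉⁅y⁆⇒x≢y ∘ Subset.x∈∁p⇒x∉p) vs⊆)
    where
    outside-x : ∀ {a} → a ≢ x → a ∈ˢ ∁ ⁅ x ⁆
    outside-x = Subset.x∉p⇒x∈∁p ∘ Subset.x≢y⇒x∉⁅y⁆

  biconnected⊎1-cutset : Biconnected ⊎ HasCutset G 1
  biconnected⊎1-cutset with all? connectedWithout?
  ... | yes conn = inj₁ conn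
  ... | no ¬conn =
    let x , ¬connₓ = ¬∀⟶∃¬ n ConnectedWithout connectedWithout? ¬conn
    in inj₂ (⁅ x ⁆ , ¬connectedWithout⇒1-cutset ¬connₓ)

-- Separating the ends of an edge

module _ (G : Graph n) (biconnected : Biconnected G) {u v : Fin n} (u~v : Graph._~_ G u v) where
  open Graph G renaming (sym to ~-sym)

  private
    H : Graph n
    H = delete G u v

    open Graph H using () renaming (_~_ to _~ᴴ_)

    u≢v : u ≢ v
    u≢v refl = irrefl refl u~v

  delete-edge-cases : ∀ {a b} → a ~ b → (a ≡ u × b ≡ v) ⊎ (a ≡ v × b ≡ u) ⊎ a ~ᴴ b
  delete-edge-cases {a} {b} e with (a ≟ u) ×-dec (b ≟ v) | (a ≟ v) ×-dec (b ≟ u)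
  ... | yes uv | _      = inj₁ uv
  ... | no _   | yes vu = inj₂ (inj₁ vu)
  ... | no ¬uv | no ¬vu = inj₂ (inj₂ (e , ¬uv , ¬vu))

  reverseᴴ : {P : Pred (Fin n) 0ℓ} → Symmetric (Star (Inside H P))
  reverseᴴ = reverse λ (e , Pa , Pb) → Graph.sym H e , Pb , Pa

  -- Vacuous at `u` and `v`, so that any vertex where it fails is a third vertex separating `u` from
  -- `v` in `H`.
  Linked : Pred (Fin n) 0ℓ
  Linked x = x ≢ u → x ≢ v → Star (Inside H (_≢ x)) u v

  linked? : Unary.Decidable Linked
  linked? x = ¬? (x ≟ u) →-dec (¬? (x ≟ v) →-dec connectedInside? H (∁? (_≟ x)) u v)

  -- Each use of `uv` in a walk of `G` avoiding `w` is replaced by a walk of `H` between its ends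
  -- that avoids `w`.
  linked⇒avoidable : (∀ x → Linked x) →
    ∀ w → w ≢ u → ∀ z → z ≢ w → Star (Inside H (_≢ w)) z u
  linked⇒avoidable linked w w≢u z z≢w =
    kleisliStar id reroute (biconnected w z u z≢w (≢-sym w≢u))
    where
    reroute : ∀ {a b} → Inside G (_≢ w) a b → Star (Inside H (_≢ w)) a b
    reroute (e , a≢w , b≢w) with delete-edge-cases e
    ... | inj₁ (refl , refl)        = linked w w≢u (≢-sym b≢w)
    ... | inj₂ (inj₁ (refl , refl)) = reverseᴴ (linked w w≢u (≢-sym a≢w))
    ... | inj₂ (inj₂ eᴴ)            = (eᴴ , a≢w , b≢w) ◅ ε

  ¬linked : Chordless G → 3 ≤ deg G u → ¬ (∀ x → Linked x)
  ¬linked chordless 3≤deg-u linked =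
    -- `Linked` gives a walk from `u` to `v` in `H` only at a third vertex; another neighbour of `u`
    -- supplies one.
    let y , u~y , y∉ = fresh-neighbour G (v ∷ []) (ℕ.<⇒≤ 3≤deg-u)
        u↝v = linked y (λ y≡u → irrefl (sym y≡u) u~y) (λ y≡v → y∉ (here y≡v))
        F = fan H u (linked⇒avoidable linked) (≢-sym u≢v) (Star.map proj₁ (reverseᴴ u↝v))
        w , vs , P , w~u , u∈ , v∈ =
          fan⇒cycle H u (λ (_ , _ , ¬vu) → ¬vu (refl , refl)) F
    in ¬cycle-through-deleted-edge G chordless u~v P w~u u∈ v∈

  -- The sides are the components of `u` and `v` in `H` without `x`. Any edge between them other
  -- than `uv` would lie in `H` and merge them.
  separated⇒bridge : ∀ x → x ≢ u → x ≢ v → ¬ Star (Inside H (_≢ x)) u v → Bridge G x u v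
  separated⇒bridge x x≢u x≢v sep = record
    { U = Star (Inside H (_≢ x)) u
    ; V = Star (Inside H (_≢ x)) v
    ; U? = connectedInside? H (∁? (_≟ x)) u
    ; V? = connectedInside? H (∁? (_≟ x)) v
    ; u∈U = ε
    ; v∈V = ε
    ; x∉U = λ R → avoids (≢-sym x≢u) R refl
    ; x∉V = λ R → avoids (≢-sym x≢v) R refl
    ; disjoint = λ Uz Vz → sep (Uz ◅◅ reverseᴴ Vz)
    ; cover = λ z z≢x → side (biconnected x z u z≢x (≢-sym x≢u))
    ; bridge = only-uv
    }
    where
    avoids : ∀ {a b} → a ≢ x → Star (Inside H (_≢ x)) a b → b ≢ x
    avoids a≢x ε = a≢x
    avoids _ ((_ , _ , b≢x) ◅ R) = avoids b≢x R

    -- Up to its first use of `uv`, or to its end if there is none, the walk lies in `H` and so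
    -- links `z` to `u` or `v`.
    side : ∀ {z} → Star (Inside G (_≢ x)) z u →
      Star (Inside H (_≢ x)) u z ⊎ Star (Inside H (_≢ x)) v z
    side ε = inj₁ ε
    side ((e , z≢x , w≢x) ◅ R) with delete-edge-cases e
    ... | inj₁ (refl , _)        = inj₁ ε
    ... | inj₂ (inj₁ (refl , _)) = inj₂ ε
    ... | inj₂ (inj₂ eᴴ)         = Sum.map (_◅◅ back) (_◅◅ back) (side R)
      where back = (Graph.sym H eᴴ , w≢x , z≢x) ◅ ε

    only-uv : ∀ {y z} → y ~ z → Star (Inside H (_≢ x)) u y → Star (Inside H (_≢ x)) v z →
      y ≡ u × z ≡ v
    only-uv e Uy Vz with delete-edge-cases e
    ... | inj₁ uv                = uv
    ... | inj₂ (inj₁ (refl , _)) = contradiction Uy sep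
    ... | inj₂ (inj₂ eᴴ)         = contradiction (Uy ◅◅ (eᴴ , y≢x , z≢x) ◅ reverseᴴ Vz) sep
      where
      y≢x = avoids (≢-sym x≢u) Uy
      z≢x = avoids (≢-sym x≢v) Vz

  separator : Chordless G → 3 ≤ deg G u → ∃[ x ] Bridge G x u v
  separator chordless 3≤deg-u =
    let x , ¬linkedₓ = ¬∀⟶∃¬ n Linked linked? (¬linked chordless 3≤deg-u)
    in x , separated⇒bridge x
         (λ x≡u → ¬linkedₓ λ x≢u → contradiction x≡u x≢u)
         (λ x≡v → ¬linkedₓ λ _ x≢v → contradiction x≡v x≢v)
         (λ R → ¬linkedₓ λ _ _ → R)

  bridge⇒HasProper2Cutset : ∀ {x} → Bridge G x u v → Chordless G →
    3 ≤ deg G u → 3 ≤ deg G v → HasProper2Cutset G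
  bridge⇒HasProper2Cutset {x} B chordless 3≤deg-u 3≤deg-v = by-adjacency (u ~? x) (v ~? x)
    where
    by-adjacency : Dec (u ~ x) → Dec (v ~ x) → HasProper2Cutset G
    by-adjacency (no u≁x)  _         = u , x , bridge⇒proper2Cutset B 3≤deg-u 3≤deg-v u≁x
    by-adjacency (yes _)   (no v≁x)  = v , x , bridge⇒proper2Cutset (swapBridge B) 3≤deg-v 3≤deg-u v≁x
    by-adjacency (yes u~x) (yes v~x) =
      ⊥-elim (¬bridge-in-triangle B chordless 3≤deg-u u~v u~x (~-sym v~x) reach-x)
      where
      reach-x : ∀ y → y ≢ u → Star (Inside G (_≢ u)) y x
      reach-x y y≢u = biconnected u y x y≢u λ x≡u → irrefl (sym x≡u) u~x

  biconnected⇒proper2Cutset : Chordless G → 3 ≤ deg G u → 3 ≤ deg G v → HasProper2Cutset G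
  biconnected⇒proper2Cutset chordless 3≤deg-u 3≤deg-v =
    bridge⇒HasProper2Cutset (proj₂ (separator chordless 3≤deg-u)) chordless 3≤deg-u 3≤deg-v

theorem1p3 : (n : ℕ) (G : Graph n) → Chordless G →
    Sparse G ⊎ (HasCutset G 1 ⊎ HasProper2Cutset G)
theorem1p3 n G chordless with biconnected⊎1-cutset G
... | inj₂ cut = inj₂ (inj₁ cut)
... | inj₁ biconnected
  with any? (λ u → any? λ v → (u ~? v) ×-dec ((3 ℕ.≤? deg G u) ×-dec (3 ℕ.≤? deg G v)))
  where open Graph G
...   | yes (u , v , u~v , 3≤deg-u , 3≤deg-v) =
  inj₂ (inj₂ (biconnected⇒proper2Cutset G biconnected u~v chordless 3≤deg-u 3≤deg-v))
...   | no sparse = inj₁ low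
  where
  low : Sparse G
  low u v u~v with deg G u ℕ.≤? 2 | deg G v ℕ.≤? 2
  ... | yes u≤2 | _       = inj₁ u≤2
  ... | no _    | yes v≤2 = inj₂ v≤2
  ... | no u≰2  | no v≰2  = contradiction (u , v , u~v , ℕ.≰⇒> u≰2 , ℕ.≰⇒> v≰2) sparse
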